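{- Let $n \geq 2$, and regard $\ell_{T(A_n)}$ as a random variable on $A_n$ with the uniform distribution. Then $$E[\ell_{T(A_n)}] = n - H_n - \tfrac{1}{2}$$ and $$\mathrm{Var}[\ell_{T(A_n)}] = H_n - H_{n,2} - \tfrac{1}{4}.$$
   Context: $A_n$ is the alternating group on $\{1,\dots,n\}$. Set $T(A_n) = \{(1\,2)(i\,j) \mid 1 \le i<j \le n\}$, a generating set of $A_n$. The length $\ell_{T(A_n)}(v)$ is the minimal $k\ge0$ such that $v$ is a product of $k$ elements of $T(A_n)$. For a function $s$ on a finite set $A$, $E[s] = \frac{1}{|A|}\sum_{a\in A} s(a)$ and $\mathrm{Var}[s] = E[s^2] - E[s]^2$. The harmonic numbers are $H_n = \sum_{i=1}^n \frac1i$ and $H_{n,2} = \sum_{i=1}^n \frac{1}{i^2}$. -}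

module Defs where

open import Data.Nat as ℕ using (ℕ; zero; suc; _<_; _≤_)
open import Data.Nat.Properties using (_<?_)
open import Data.Fin as Fin using (Fin; toℕ)
open import Data.Fin.Properties using (_≟_)
open import Data.Vec as Vec using (Vec; []; _∷_; lookup; tabulate)
open import Data.List as List using (List; []; _∷_; length; map; concatMap; filter; allFin; foldr)
open import Data.Bool using (Bool; true; false; _∧_; _∨_; not)
open import Data.Bool.Properties using () renaming (_≟_ to _≟B_)
open import Data.Product using (Σ; ∃; _×_; _,_; proj₁; proj₂)
open import Data.Integer as ℤ using (+_)
open import Data.Rational as ℚ using (ℚ; 0ℚ; _+_; _*_; _-_; _/_)
open import Relation.Nullary.Decidable using (⌊_⌋)
open import Relation.Binary.PropositionalEquality using (_≡_)

-- Permutations of {1,…,n}, encoded as Fin n (0 ↦ 1, 1 ↦ 2, …).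
-- A permutation σ is represented by its table of values
-- (σ(0), …, σ(n-1)) : Vec (Fin n) n.

Perm : ℕ → Set
Perm n = Vec (Fin n) n

allVecs : (n k : ℕ) → List (Vec (Fin n) k)
allVecs n zero    = [] ∷ []
allVecs n (suc k) = concatMap (λ x → map (x ∷_) (allVecs n k)) (allFin n)

allB : {A : Set} → (A → Bool) → List A → Bool
allB p = foldr (λ x b → p x ∧ b) true

isPerm : {n : ℕ} → Vec (Fin n) n → Bool
isPerm {n} σ = allB (λ i → allB (λ j →
                 ⌊ i ≟ j ⌋ ∨ not ⌊ lookup σ i ≟ lookup σ j ⌋)
                 (allFin n)) (allFin n)

countB : {A : Set} → (A → Bool) → List A → ℕ
countB p xs = length (filter (λ x → p x ≟B true) xs)

inversions : {n : ℕ} → Perm n → ℕ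
inversions {n} σ = countB (λ ij → ⌊ toℕ (proj₁ ij) <? toℕ (proj₂ ij) ⌋
                                    ∧ ⌊ toℕ (lookup σ (proj₂ ij)) <? toℕ (lookup σ (proj₁ ij)) ⌋)
                          (concatMap (λ i → map (i ,_) (allFin n)) (allFin n))

isEven : ℕ → Bool
isEven zero          = true
isEven (suc zero)    = false
isEven (suc (suc k)) = isEven k

-- The alternating group A_n as the list of even permutations of {1,…,n}
-- (each element listed exactly once).
Alt : (n : ℕ) → List (Perm n)
Alt n = filter (λ σ → (isPerm σ ∧ isEven (inversions σ)) ≟B true) (allVecs n n)

idP : (n : ℕ) → Perm n
idP n = tabulate (λ i → i)

_∘P_ : {n : ℕ} → Perm n → Perm n → Perm n
σ ∘P τ = tabulate (λ i → lookup σ (lookup τ i))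

transp : {n : ℕ} → Fin n → Fin n → Perm n
transp a b = tabulate (λ i → sw i)
  where
  sw : _ → _
  sw i with ⌊ i ≟ a ⌋ | ⌊ i ≟ b ⌋
  ... | true  | _     = b
  ... | false | true  = a
  ... | false | false = i

-- T(A_n) for n = m + 2: the elements (1 2)(i j) with 1 ≤ i < j ≤ n.
-- Here 1,2 are encoded as Fin.zero, Fin.suc Fin.zero.
gen : (m : ℕ) → Fin (suc (suc m)) → Fin (suc (suc m)) → Perm (suc (suc m))
gen m i j = transp Fin.zero (Fin.suc Fin.zero) ∘P transp i j

GenIdx : ℕ → Set
GenIdx n = Σ (Fin n) (λ i → Σ (Fin n) (λ j → toℕ i < toℕ j))

prodWord : (m : ℕ) → List (GenIdx (suc (suc m))) → Perm (suc (suc m))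
prodWord m []                    = idP _
prodWord m ((i , j , _) ∷ w)     = gen m i j ∘P prodWord m w

IsProdOf : (m : ℕ) → ℕ → Perm (suc (suc m)) → Set
IsProdOf m k v = Σ (List (GenIdx (suc (suc m)))) (λ w → length w ≡ k × prodWord m w ≡ v)

IsLengthOf : (m : ℕ) → ℕ → Perm (suc (suc m)) → Set
IsLengthOf m l v = IsProdOf m l v × ((k : ℕ) → IsProdOf m k v → l ≤ k)

ℕ→ℚ : ℕ → ℚ
ℕ→ℚ k = (+ k) / 1

sumℚ : {A : Set} → (A → ℚ) → List A → ℚ
sumℚ f = foldr (λ x acc → f x + acc) 0ℚ

-- E[s] = (1/|A|) Σ_{a ∈ A} s(a)   (0 for the empty list, never used)
E : {A : Set} → List A → (A → ℚ) → ℚ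
E [] f        = 0ℚ
E (x ∷ xs) f  = sumℚ f (x ∷ xs) * ((+ 1) / suc (length xs))

Var : {A : Set} → List A → (A → ℚ) → ℚ
Var xs f = E xs (λ a → f a * f a) - E xs f * E xs f

H : ℕ → ℚ
H zero    = 0ℚ
H (suc k) = H k + (+ 1) / suc k

H2 : ℕ → ℚ
H2 zero    = 0ℚ
H2 (suc k) = H2 k + (+ 1) / (suc k ℕ.* suc k)

{-# OPTIONS --safe #-}

-- Put τ = (1 2). Since the generators are τ(i j) and τ normalises the set of transpositions,
-- a product of k generators is a product of k transpositions times τ^k. Hence the length of
-- v is the least k such that v lies in the coset of some product of k transpositions modulo
-- right multiplication by τ. Every such coset contains exactly one product
-- (a_n n) ⋯ (a_3 3) with a_N ≤ N, where (N N) is the identity; its number of nontrivial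
-- factors is the length, because multiplying by a transposition on the left raises this
-- number by at most 1. The even permutations are thus in bijection with the sequences
-- (a_3, …, a_n), and the length becomes a sum of independent Bernoulli variables with
-- success probabilities 1 - 1/N, N = 3, …, n.

module Submission where

open import Defs
open import Data.Nat using (ℕ; suc)
open import Data.List.Membership.Propositional using (_∈_)
open import Data.Product using (_×_)
open import Data.Integer using (+_)
open import Data.Rational using (ℚ; _-_; _/_)
open import Relation.Binary.PropositionalEquality using (_≡_)

open import Data.Bool using (Bool; true; false; not; _∧_; _∨_)
open import Data.Bool.Properties using (not-involutive) renaming (_≟_ to _≟B_)
open import Data.Fin.Base using (Fin; toℕ; fromℕ<; zero; suc)
open import Data.Fin.Properties using (toℕ<n; toℕ-fromℕ<; toℕ-injective; fromℕ<-toℕ)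
  renaming (_≟_ to _≟F_)
import Data.Integer as ℤ
import Data.Integer.Properties as ℤₚ
open import Data.List.Base using (List; []; _∷_; _++_; map; concatMap; length; allFin; cartesianProductWith)
open import Data.List.Membership.Propositional.Properties
  using (∈-allFin; ∈-++⁺ˡ; ∈-++⁺ʳ; ∈-map⁺; ∈-map⁻; ∈-filter⁺; ∈-filter⁻; ∈-cartesianProduct⁺;
         ∈-cartesianProductWith⁺; ∈-cartesianProductWith⁻)
open import Data.List.Membership.Propositional.Properties.WithK using (unique∧set⇒bag)
open import Data.List.Properties using (length-tabulate)
open import Data.List.Relation.Binary.BagAndSetEquality using (∼bag⇒↭)
open import Data.List.Relation.Binary.Permutation.Propositional as ↭ using (_↭_)
import Data.List.Relation.Unary.All as All
open import Data.List.Relation.Unary.AllPairs using ([]; _∷_)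
open import Data.List.Relation.Unary.Any using (here; there)
open import Data.List.Relation.Unary.Unique.Propositional using (Unique)
import Data.List.Relation.Unary.Unique.Propositional.Properties as Uniqueₚ
open import Data.Nat as ℕ using (zero)
import Data.Nat.Properties as ℕₚ
open import Data.Product using (Σ; ∃-syntax; _,_; proj₁; proj₂)
open import Data.Rational using (1ℚ; fromℚᵘ; toℚᵘ)
open import Data.Rational.Properties
  using (+-identityˡ; +-assoc; *-zeroˡ; *-identityʳ; toℚᵘ-injective; toℚᵘ-fromℚᵘ; toℚᵘ-homo-+;
         toℚᵘ-homo-*; fromℚᵘ-cong)
open import Data.Rational.Solver using (module +-*-Solver)
import Data.Rational.Unnormalised as ℚᵘ
import Data.Rational.Unnormalised.Properties as ℚᵘₚ
open import Data.Sum using (_⊎_; inj₁; inj₂)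
open import Data.Vec.Base using (Vec; []; _∷_; lookup; tabulate)
open import Data.Vec.Properties using (lookup∘tabulate; tabulate∘lookup; tabulate-cong; ∷-injective)
open import Function.Base using (_∘_; id; const; _∋_)
open import Function.Bundles using (mk⇔)
open import Relation.Binary.Definitions using (tri<; tri≈; tri>)
open import Relation.Binary.PropositionalEquality
  using (_≢_; _≗_; refl; sym; trans; cong; cong₂; subst; subst₂; module ≡-Reasoning)
open import Relation.Nullary using (yes; no; contradiction; ¬_; ⌊_⌋)

module _ where
  open import Data.Nat
    using (_+_; _≤_; _<_; _≟_; _<?_; z≤n; s≤s; z<s; s<s; s≤s⁻¹)
  open import Data.Nat.Properties
    using (≤-refl; ≤-reflexive; ≤-trans; <-trans; <-irrefl; <-asym; <⇒≢; >⇒≢; <⇒≱; <⇒≯; ≮⇒≥;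
           ≤∧≢⇒<; <-cmp; n<1+n; n≤1+n; m<n⇒m<1+n; m<1+n⇒m<n∨m≡n; +-suc)

  -- Permutations of ℕ as products of transpositions

  opaque
    swap : ℕ → ℕ → ℕ → ℕ
    swap a b x with x ≟ a | x ≟ b
    ... | yes _ | _     = b
    ... | no _  | yes _ = a
    ... | no _  | no _  = x

    swap-ˡ : ∀ a b → swap a b a ≡ b
    swap-ˡ a b with a ≟ a
    ... | yes _  = refl
    ... | no a≢a = contradiction refl a≢a

    swap-ʳ : ∀ a b → swap a b b ≡ a
    swap-ʳ a b with b ≟ a | b ≟ b
    ... | yes b≡a | _      = b≡a
    ... | no _    | yes _  = refl
    ... | no _    | no b≢b = contradiction refl b≢b

    swap-other : ∀ {a b x} → x ≢ a → x ≢ b → swap a b x ≡ x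
    swap-other {a} {b} {x} x≢a x≢b with x ≟ a | x ≟ b
    ... | yes x≡a | _       = contradiction x≡a x≢a
    ... | no _    | yes x≡b = contradiction x≡b x≢b
    ... | no _    | no _    = refl

    -- The conjugation rule f (a b) f⁻¹ = (f a f b) with `f` moved to the right, so that no inverse
    -- occurs and injectivity is enough. Every rewriting of products below rests on it.
    swap-conj : ∀ {f : ℕ → ℕ} → (∀ {x y} → f x ≡ f y → x ≡ y) →
                ∀ a b x → f (swap a b x) ≡ swap (f a) (f b) (f x)
    swap-conj {f} f-inj a b x with x ≟ a | x ≟ b
    ... | yes refl | _        = sym (swap-ˡ (f a) (f b))
    ... | no _     | yes refl = sym (swap-ʳ (f a) (f b))
    ... | no x≢a   | no x≢b   = sym (swap-other (x≢a ∘ f-inj) (x≢b ∘ f-inj))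

    swap-involutive : ∀ a b x → swap a b (swap a b x) ≡ x
    swap-involutive a b x with x ≟ a | x ≟ b
    ... | yes refl | _        = swap-ʳ x b
    ... | no _     | yes refl = swap-ˡ a x
    ... | no x≢a   | no x≢b   = swap-other x≢a x≢b

    swap-injective : ∀ a b {x y} → swap a b x ≡ swap a b y → x ≡ y
    swap-injective a b {x} {y} eq = begin
      x                       ≡⟨ swap-involutive a b x ⟨
      swap a b (swap a b x)   ≡⟨ cong (swap a b) eq ⟩
      swap a b (swap a b y)   ≡⟨ swap-involutive a b y ⟩
      y                       ∎
      where open ≡-Reasoning

    swap-comm : ∀ a b x → swap a b x ≡ swap b a x
    swap-comm a b x with x ≟ a | x ≟ b
    ... | yes refl | yes refl = refl
    ... | yes refl | no _     = refl
    ... | no _     | yes refl = refl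
    ... | no _     | no _     = refl

    swap-same : ∀ a x → swap a a x ≡ x
    swap-same a x with x ≟ a
    ... | yes refl = refl
    ... | no _     = refl

    swap-< : ∀ {n a b x} → a < n → b < n → x < n → swap a b x < n
    swap-< {a = a} {b} {x} a<n b<n x<n with x ≟ a | x ≟ b
    ... | yes _ | _     = b<n
    ... | no _  | yes _ = a<n
    ... | no _  | no _  = x<n

  swap-≥ : ∀ {n a b x} → a < n → b < n → n ≤ x → swap a b x ≡ x
  swap-≥ a<n b<n n≤x = swap-other (>⇒≢ (≤-trans a<n n≤x)) (>⇒≢ (≤-trans b<n n≤x))

  -- Permutations of n points are extended to all of ℕ by fixed points, so that composition and the
  -- passage from n to n + 1 need no change of type. Surjectivity is a field because preimages are
  -- needed to locate given values.
  record FinPerm (n : ℕ) (f : ℕ → ℕ) : Set where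
    field
      injective  : ∀ {x y} → f x ≡ f y → x ≡ y
      surjective : ∀ y → ∃[ x ] f x ≡ y
      fixes      : ∀ {x} → n ≤ x → f x ≡ x

    preserves-< : ∀ {x} → x < n → f x < n
    preserves-< {x} x<n with f x <? n
    ... | yes fx<n = fx<n
    ... | no fx≮n  = contradiction
      (subst (n ≤_) (injective (fixes (≮⇒≥ fx≮n))) (≮⇒≥ fx≮n)) (<⇒≱ x<n)

    reflects-< : ∀ {x} → f x < n → x < n
    reflects-< {x} fx<n with x <? n
    ... | yes x<n = x<n
    ... | no x≮n  = contradiction (subst (_< n) (fixes (≮⇒≥ x≮n)) fx<n) x≮n

  swap-finPerm : ∀ {n a b f g} → a < n → b < n → FinPerm n g → f ≗ swap a b ∘ g → FinPerm n f
  swap-finPerm {n} {a} {b} {f} {g} a<n b<n gP f≗ = record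
    { injective  = λ {x} {y} eq →
        injective (swap-injective a b (trans (sym (f≗ x)) (trans eq (f≗ y))))
    ; surjective = λ y → let x , gx≡ = surjective (swap a b y) in
        x , trans (f≗ x) (trans (cong (swap a b) gx≡) (swap-involutive a b y))
    ; fixes      = λ {x} n≤x →
        trans (f≗ x) (trans (cong (swap a b) (fixes n≤x)) (swap-≥ a<n b<n n≤x))
    }
    where open FinPerm gP

  -- Products of k transpositions and powers of τ.

  τ : ℕ → ℕ
  τ = swap 0 1

  τ^ : ℕ → ℕ → ℕ
  τ^ zero    x = x
  τ^ (suc k) x = τ (τ^ k x)

  τ-< : ∀ {m x} → x < 2 + m → τ x < 2 + m
  τ-< = swap-< z<s (s<s z<s)

  τ^-+ : ∀ j k x → τ^ (j + k) x ≡ τ^ j (τ^ k x)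
  τ^-+ zero    k x = refl
  τ^-+ (suc j) k x = cong τ (τ^-+ j k x)

  τ^-≥ : ∀ k {x} → 2 ≤ x → τ^ k x ≡ x
  τ^-≥ zero    2≤x = refl
  τ^-≥ (suc k) 2≤x = trans (cong τ (τ^-≥ k 2≤x)) (swap-≥ z<s (s<s z<s) 2≤x)

  -- Functions enter only up to `≗`, which avoids extensionality. The condition `i ≢ j` makes each
  -- factor a genuine transposition, so that k fixes the parity of the product.
  data SwapProduct (n : ℕ) : ℕ → (ℕ → ℕ) → Set where
    unit : ∀ {f} → f ≗ id → SwapProduct n 0 f
    mult : ∀ {k f g i j} → i ≢ j → i < n → j < n →
           SwapProduct n k g → f ≗ swap i j ∘ g → SwapProduct n (suc k) f

  swapProduct-finPerm : ∀ {n k f} → SwapProduct n k f → FinPerm n f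
  swapProduct-finPerm (unit f≗) = record
    { injective  = λ {x} {y} eq → trans (sym (f≗ x)) (trans eq (f≗ y))
    ; surjective = λ y → y , f≗ y
    ; fixes      = λ {x} _ → f≗ x
    }
  swapProduct-finPerm (mult _ i<n j<n p f≗) = swap-finPerm i<n j<n (swapProduct-finPerm p) f≗

  swapProduct-∘ : ∀ {n j k f g} → SwapProduct n j f → SwapProduct n k g → SwapProduct n (j + k) (f ∘ g)
  swapProduct-∘ {g = g} (unit f≗) (unit g≗) = unit (λ x → trans (f≗ (g x)) (g≗ x))
  swapProduct-∘ {g = g} (unit f≗) (mult i≢j i<n j<n q g≗) =
    mult i≢j i<n j<n q (λ x → trans (f≗ (g x)) (g≗ x))
  swapProduct-∘ {g = g} (mult i≢j i<n j<n p f≗) q =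
    mult i≢j i<n j<n (swapProduct-∘ p q) (f≗ ∘ g)

  swapProduct-mono : ∀ {n k f} → SwapProduct n k f → SwapProduct (suc n) k f
  swapProduct-mono (unit f≗) = unit f≗
  swapProduct-mono (mult i≢j i<n j<n p f≗) =
    mult i≢j (m<n⇒m<1+n i<n) (m<n⇒m<1+n j<n) (swapProduct-mono p) f≗

  -- Conjugation works factor by factor: (i j) becomes (τ i τ j), and the number of factors is kept.
  swapProduct-conj : ∀ {m k f} → SwapProduct (2 + m) k f → SwapProduct (2 + m) k (τ ∘ f ∘ τ)
  swapProduct-conj (unit f≗) = unit (λ x → trans (cong τ (f≗ (τ x))) (swap-involutive 0 1 x))
  swapProduct-conj (mult {g = g} {i} {j} i≢j i<n j<n p f≗) =
    mult (i≢j ∘ swap-injective 0 1) (τ-< i<n) (τ-< j<n) (swapProduct-conj p)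
      (λ x → trans (cong τ (f≗ (τ x))) (swap-conj (swap-injective 0 1) i j (g (τ x))))

  τ^-swapProduct : ∀ {m} k → SwapProduct (2 + m) k (τ^ k)
  τ^-swapProduct zero    = unit (λ _ → refl)
  τ^-swapProduct (suc k) = mult (λ ()) z<s (s<s z<s) (τ^-swapProduct k) (λ _ → refl)

  -- Codes and their uniqueness within a coset of τ.

  -- Points are numbered from 0, so that a code picks for each N = 2, …, m + 1 either no factor
  -- or a transposition (a N) with a < N.
  data Code : ℕ → Set where
    ε    : Code 0
    stay : ∀ {m} → Code m → Code (suc m)
    move : ∀ {m} → Fin (2 + m) → Code m → Code (suc m)

  weight : ∀ {m} → Code m → ℕ
  weight ε          = 0
  weight (stay c)   = weight c
  weight (move _ c) = suc (weight c)

  ⟦_⟧ : ∀ {m} → Code m → ℕ → ℕ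
  ⟦ ε ⟧            x = x
  ⟦ stay c ⟧       x = ⟦ c ⟧ x
  ⟦ move {m} a c ⟧ x = swap (toℕ a) (2 + m) (⟦ c ⟧ x)

  ⟦⟧-swapProduct : ∀ {m} (c : Code m) → SwapProduct (2 + m) (weight c) ⟦ c ⟧
  ⟦⟧-swapProduct ε          = unit (λ _ → refl)
  ⟦⟧-swapProduct (stay c)   = swapProduct-mono (⟦⟧-swapProduct c)
  ⟦⟧-swapProduct (move a c) =
    mult (<⇒≢ (toℕ<n a)) (m<n⇒m<1+n (toℕ<n a)) ≤-refl (swapProduct-mono (⟦⟧-swapProduct c)) (λ _ → refl)

  ⟦⟧-≥ : ∀ {m} (c : Code m) {x} → 2 + m ≤ x → ⟦ c ⟧ x ≡ x
  ⟦⟧-≥ c = FinPerm.fixes (swapProduct-finPerm (⟦⟧-swapProduct c))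

  -- The powers of τ and the factors of `c` move smaller points only. Hence the image of `2 + m`
  -- under a longer code depends on its outermost choice alone.
  ⟦⟧-top : ∀ {m} (c : Code m) e → ⟦ c ⟧ (τ^ e (2 + m)) ≡ 2 + m
  ⟦⟧-top c e = trans (cong ⟦ c ⟧ (τ^-≥ e (s≤s (s≤s z≤n)))) (⟦⟧-≥ c ≤-refl)

  -- The image of the top point reveals the outermost choice, which is then peeled off. The
  -- exponents may differ, so a whole coset modulo τ has at most one code.
  ⟦⟧-unique : ∀ {m} (c c′ : Code m) e e′ →
              (∀ {x} → x < 2 + m → ⟦ c ⟧ (τ^ e x) ≡ ⟦ c′ ⟧ (τ^ e′ x)) → c ≡ c′
  ⟦⟧-unique ε ε e e′ eq = refl
  ⟦⟧-unique (stay c) (stay c′) e e′ eq = cong stay (⟦⟧-unique c c′ e e′ (eq ∘ m<n⇒m<1+n))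
  -- `stay` fixes the top point `2 + m`, while `move a` sends it to a smaller one.
  ⟦⟧-unique {suc m} (stay c) (move a c′) e e′ eq = contradiction
    (trans (sym (⟦⟧-top c e)) (trans (eq ≤-refl)
      (trans (cong (swap (toℕ a) (2 + m)) (⟦⟧-top c′ e′)) (swap-ʳ (toℕ a) (2 + m)))))
    (>⇒≢ (toℕ<n a))
  ⟦⟧-unique {suc m} (move a c) (stay c′) e e′ eq = contradiction
    (trans (sym (⟦⟧-top c′ e′)) (trans (sym (eq ≤-refl))
      (trans (cong (swap (toℕ a) (2 + m)) (⟦⟧-top c e)) (swap-ʳ (toℕ a) (2 + m)))))
    (>⇒≢ (toℕ<n a))
  ⟦⟧-unique {suc m} (move a c) (move a′ c′) e e′ eq
    -- Both sides send the top point to the index of their outermost factor, so these indices agree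
    -- and the factor cancels.
    with refl ← toℕ-injective {i = a} {a′}
      (trans (sym (swap-ʳ (toℕ a) (2 + m)))
      (trans (cong (swap (toℕ a) (2 + m)) (sym (⟦⟧-top c e)))
      (trans (eq ≤-refl)
      (trans (cong (swap (toℕ a′) (2 + m)) (⟦⟧-top c′ e′))
             (swap-ʳ (toℕ a′) (2 + m))))))
    = cong (move a) (⟦⟧-unique c c′ e e′ (swap-injective (toℕ a) (2 + m) ∘ eq ∘ m<n⇒m<1+n))

  -- Left multiplication of a code by a transposition.

  -- The product is coded again, up to a power of τ on the right, and costs at most one more factor.
  -- This bound is the source of the lower bound on the length.
  Insertion : ∀ {m} → ℕ → ℕ → Code m → Set
  Insertion {m} i j c = ∃[ c′ ] ∃[ e ] weight {m} c′ ≤ suc (weight c) × swap i j ∘ ⟦ c ⟧ ≗ ⟦ c′ ⟧ ∘ τ^ e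

  insertion-sym : ∀ {m} i j (c : Code m) → Insertion i j c → Insertion j i c
  insertion-sym i j c (c′ , e , w , eq) =
    c′ , e , w , λ x → trans (swap-comm j i (⟦ c ⟧ x)) (eq x)

  insert-same : ∀ {m} i (c : Code m) → Insertion i i c
  insert-same i c = c , 0 , n≤1+n _ , λ x → swap-same i (⟦ c ⟧ x)

  -- Besides (a N)(a N) = 1, the rewriting rule is (N j)(a N) = (a N)(a j).
  insert-top : ∀ {m j} (c : Code (suc m)) → j < 2 + m →
               (∀ {a b} (d : Code m) → a < 2 + m → b < 2 + m → Insertion a b d) →
               Insertion j (2 + m) c
  insert-top {m} {j} (stay c) j<N rec =
    move (fromℕ< j<N) c , 0 , ≤-refl ,
    λ x → cong (λ b → swap b (2 + m) (⟦ c ⟧ x)) (sym (toℕ-fromℕ< j<N))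
  insert-top {m} {j} (move a c) j<N rec with j ≟ toℕ a
  ... | yes refl =
    stay c , 0 , ≤-trans (n≤1+n _) (n≤1+n _) , λ x → swap-involutive (toℕ a) (2 + m) (⟦ c ⟧ x)
  ... | no j≢a =
    let c′ , e , w , eq = rec c (toℕ<n a) j<N in
    move a c′ , e , s≤s w , λ x → begin
      swap j N (swap a′ N (⟦ c ⟧ x))
        ≡⟨ swap-comm j N (swap a′ N (⟦ c ⟧ x)) ⟩
      swap N j (swap a′ N (⟦ c ⟧ x))
        ≡⟨ cong₂ (λ u v → swap u v (swap a′ N (⟦ c ⟧ x))) (swap-ˡ a′ N) (swap-other j≢a (<⇒≢ j<N)) ⟨
      swap (swap a′ N a′) (swap a′ N j) (swap a′ N (⟦ c ⟧ x))
        ≡⟨ swap-conj (swap-injective a′ N) a′ j (⟦ c ⟧ x) ⟨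
      swap a′ N (swap a′ j (⟦ c ⟧ x))
        ≡⟨ cong (swap a′ N) (eq x) ⟩
      swap a′ N (⟦ c′ ⟧ (τ^ e x)) ∎
    where
    open ≡-Reasoning
    a′ = toℕ a
    N = 2 + m

  -- Uses (i j)(a N) = (a′ N)(i j) with a′ the image of a under (i j).
  insert-below : ∀ {m i j} (c : Code (suc m)) → i < 2 + m → j < 2 + m →
                 (∀ {a b} (d : Code m) → a < 2 + m → b < 2 + m → Insertion a b d) →
                 Insertion i j c
  insert-below (stay c) i<N j<N rec =
    let c′ , e , w , eq = rec c i<N j<N in stay c′ , e , w , eq
  insert-below {m} {i} {j} (move a c) i<N j<N rec =
    let c′ , e , w , eq = rec c i<N j<N in
    move (fromℕ< a′<N) c′ , e , s≤s w , λ x → begin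
      swap i j (swap (toℕ a) N (⟦ c ⟧ x))
        ≡⟨ swap-conj (swap-injective i j) (toℕ a) N (⟦ c ⟧ x) ⟩
      swap (swap i j (toℕ a)) (swap i j N) (swap i j (⟦ c ⟧ x))
        ≡⟨ cong₂ (λ u v → swap u v (swap i j (⟦ c ⟧ x))) (sym (toℕ-fromℕ< a′<N)) (swap-≥ i<N j<N ≤-refl) ⟩
      swap (toℕ (fromℕ< a′<N)) N (swap i j (⟦ c ⟧ x))
        ≡⟨ cong (swap _ N) (eq x) ⟩
      swap (toℕ (fromℕ< a′<N)) N (⟦ c′ ⟧ (τ^ e x)) ∎
    where
    open ≡-Reasoning
    N = 2 + m
    a′<N = swap-< i<N j<N (toℕ<n a)

  -- Cases on which of the two indices is the top point. On two points the only transposition is τ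
  -- itself, which goes into the power on the right at no cost in weight.
  insert : ∀ {m i j} (c : Code m) → i < 2 + m → j < 2 + m → Insertion i j c
  insert {i = 0} {0} ε i<2 j<2 = insert-same 0 ε
  insert {i = 0} {1} ε i<2 j<2 = ε , 1 , z≤n , λ _ → refl
  insert {i = 1} {0} ε i<2 j<2 = ε , 1 , z≤n , swap-comm 1 0
  insert {i = 1} {1} ε i<2 j<2 = insert-same 1 ε
  insert {i = suc (suc _)} ε (s<s (s<s ())) j<2
  insert {j = suc (suc _)} ε i<2 (s<s (s<s ()))
  insert {suc m} {j = j} c i<n j<n with m<1+n⇒m<n∨m≡n i<n | m<1+n⇒m<n∨m≡n j<n
  ... | inj₁ i<N  | inj₁ j<N  = insert-below c i<N j<N insert
  ... | inj₁ i<N  | inj₂ refl = insert-top c i<N insert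
  ... | inj₂ refl | inj₁ j<N  = insertion-sym j (2 + m) c (insert-top c j<N insert)
  ... | inj₂ refl | inj₂ refl = insert-same (2 + m) c

  identity : ∀ m → Code m
  identity zero    = ε
  identity (suc m) = stay (identity m)

  ⟦identity⟧ : ∀ m → ⟦ identity m ⟧ ≗ id
  ⟦identity⟧ zero    x = refl
  ⟦identity⟧ (suc m) x = ⟦identity⟧ m x

  weight-identity : ∀ m → weight (identity m) ≡ 0
  weight-identity zero    = refl
  weight-identity (suc m) = weight-identity m

  -- The factors are inserted one at a time, starting from the rightmost; each adds at most 1 to the
  -- weight, and the powers of τ accumulate on the right.
  swapProduct⇒code : ∀ {m k f} → SwapProduct (2 + m) k f →
                     ∃[ c ] ∃[ e ] weight {m} c ≤ k × f ≗ ⟦ c ⟧ ∘ τ^ e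
  swapProduct⇒code {m} (unit f≗) =
    identity m , 0 , ≤-reflexive (weight-identity m) , λ x → trans (f≗ x) (sym (⟦identity⟧ m x))
  swapProduct⇒code {f = f} (mult {i = i} {j} _ i<n j<n p f≗) =
    let c , e , w , eq = swapProduct⇒code p
        c′ , e′ , w′ , eq′ = insert c i<n j<n
    in c′ , e′ + e , ≤-trans w′ (s≤s w) , λ x →
       trans (f≗ x) (trans (cong (swap i j) (eq x))
         (trans (eq′ (τ^ e x)) (cong ⟦ c′ ⟧ (sym (τ^-+ e′ e x)))))

  -- Existence of codes.

  Decomposition : ℕ → (ℕ → ℕ) → Set
  Decomposition m f = ∃[ c ] ∃[ e ] (∀ {x} → x < 2 + m → f x ≡ ⟦_⟧ {m} c (τ^ e x))

  -- Induction on the number of points: unless `f` fixes the top point N, composing it with the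
  -- transposition (f N, N) makes it do so.
  decompose : ∀ m f → (∀ {x} → x < 2 + m → f x < 2 + m) →
              (∀ {x y} → x < 2 + m → y < 2 + m → f x ≡ f y → x ≡ y) → Decomposition m f
  -- On two points an injective `f` is either the identity or τ, whence the exponents 0 and 1.
  decompose zero f f-< f-inj with f 0 in f0 | f 1 in f1 | f-< {0} z<s | f-< {1} (s<s z<s)
  ... | 0 | 0 | _ | _ = contradiction (f-inj z<s (s<s z<s) (trans f0 (sym f1))) λ ()
  ... | 1 | 1 | _ | _ = contradiction (f-inj z<s (s<s z<s) (trans f0 (sym f1))) λ ()
  ... | 0 | 1 | _ | _ = ε , 0 , λ { {0} _ → f0 ; {1} _ → f1 ; {suc (suc _)} (s<s (s<s ())) }
  ... | 1 | 0 | _ | _ = ε , 1 , λ { {0} _ → trans f0 (sym (swap-ˡ 0 1)) ; {1} _ → trans f1 (sym (swap-ʳ 0 1)) ; {suc (suc _)} (s<s (s<s ())) }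
  ... | suc (suc _) | _ | s<s (s<s ()) | _
  ... | _ | suc (suc _) | _ | s<s (s<s ())
  decompose (suc m) f f-< f-inj with m<1+n⇒m<n∨m≡n (f-< {2 + m} ≤-refl)
  ... | inj₂ fN≡N =
    let c , e , eq = decompose m f
          (λ x<N → ≤∧≢⇒< (s≤s⁻¹ (f-< (m<n⇒m<1+n x<N)))
            (λ fx≡N → <⇒≢ x<N (f-inj (m<n⇒m<1+n x<N) ≤-refl (trans fx≡N (sym fN≡N)))))
          (λ x<N y<N → f-inj (m<n⇒m<1+n x<N) (m<n⇒m<1+n y<N))
    in stay c , e , λ x<n → extend c e eq (m<1+n⇒m<n∨m≡n x<n)
    where
    extend : ∀ c e → (∀ {x} → x < 2 + m → f x ≡ ⟦ c ⟧ (τ^ e x)) →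
             ∀ {x} → x < 2 + m ⊎ x ≡ 2 + m → f x ≡ ⟦ c ⟧ (τ^ e x)
    extend c e eq (inj₁ x<N)  = eq x<N
    extend c e eq (inj₂ refl) = trans fN≡N (sym (⟦⟧-top c e))
  ... | inj₁ a<N =
    let c , e , eq = decompose m g g-<
          (λ x<N y<N → f-inj (m<n⇒m<1+n x<N) (m<n⇒m<1+n y<N) ∘ swap-injective a N)
    in move (fromℕ< a<N) c , e , λ {x} x<n → begin
         f x                                    ≡⟨ swap-involutive a N (f x) ⟨
         swap a N (g x)                         ≡⟨ cong₂ (λ b y → swap b N y) (sym (toℕ-fromℕ< a<N)) (extend c e eq (m<1+n⇒m<n∨m≡n x<n)) ⟩
         swap (toℕ (fromℕ< a<N)) N (⟦ c ⟧ (τ^ e x)) ∎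
    where
    open ≡-Reasoning
    N = 2 + m
    a = f N
    -- `g` fixes `N` and therefore, by injectivity, restricts to the points below `N`; multiplying
    -- back by (a N) recovers `f`.
    g = swap a N ∘ f
    gN≡N : g N ≡ N
    gN≡N = swap-ˡ a N
    g-< : ∀ {x} → x < N → g x < N
    g-< {x} x<N = ≤∧≢⇒< (s≤s⁻¹ (swap-< (m<n⇒m<1+n a<N) ≤-refl (f-< (m<n⇒m<1+n x<N))))
      (λ gx≡N → <⇒≢ x<N (f-inj (m<n⇒m<1+n x<N) ≤-refl (swap-injective a N (trans gx≡N (sym gN≡N)))))
    extend : ∀ c e → (∀ {x} → x < N → g x ≡ ⟦ c ⟧ (τ^ e x)) →
             ∀ {x} → x < N ⊎ x ≡ N → g x ≡ ⟦ c ⟧ (τ^ e x)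
    extend c e eq (inj₁ x<N)  = eq x<N
    extend c e eq (inj₂ refl) = trans gN≡N (sym (⟦⟧-top c e))

  -- Parity

  concatMap-map : ∀ {A B C : Set} (f : A → B → C) xs ys →
                  concatMap (λ x → map (f x) ys) xs ≡ cartesianProductWith f xs ys
  concatMap-map f []       ys = refl
  concatMap-map f (x ∷ xs) ys = cong (map (f x) ys ++_) (concatMap-map f xs ys)

  isEven-suc : ∀ n → isEven (suc n) ≡ not (isEven n)
  isEven-suc zero          = refl
  isEven-suc (suc zero)    = refl
  isEven-suc (suc (suc n)) = isEven-suc n

  isEven-n+n : ∀ n → isEven (n + n) ≡ true
  isEven-n+n zero    = refl
  isEven-n+n (suc n) = trans (cong (isEven ∘ suc) (+-suc n n)) (isEven-n+n n)

  isEven-+ : ∀ j k → isEven (j + k) ≡ true → isEven j ≡ isEven k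
  isEven-+ zero          k eq = sym eq
  isEven-+ (suc zero)    k eq with isEven k | isEven-suc k
  ... | false | _  = refl
  ... | true  | eq′ = trans (sym eq′) eq
  isEven-+ (suc (suc j)) k eq = isEven-+ j k eq

  module _ {A : Set} where

    countB-cong : ∀ {p q : A → Bool} xs → (∀ x → x ∈ xs → p x ≡ q x) → countB p xs ≡ countB q xs
    countB-cong {p} {q} []       eq = refl
    countB-cong {p} {q} (x ∷ xs) eq with p x | q x | eq x (here refl)
    ... | true  | _ | refl = cong suc (countB-cong xs (λ y → eq y ∘ there))
    ... | false | _ | refl = countB-cong xs (λ y → eq y ∘ there)

    countB-none : ∀ {p : A → Bool} xs → (∀ x → p x ≡ false) → countB p xs ≡ 0
    countB-none {p} []       eq = refl
    countB-none {p} (x ∷ xs) eq with p x | eq x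
    ... | _ | refl = countB-none xs eq

    -- As `z` occurs exactly once, the two counts differ by one. It will be applied to the
    -- inversions before and after an adjacent transposition.
    countB-flip : ∀ {p q : A → Bool} {z xs} → Unique xs → z ∈ xs →
                  p z ≡ not (q z) → (∀ x → x ≢ z → p x ≡ q x) →
                  isEven (countB p xs) ≡ not (isEven (countB q xs))
    countB-flip {p} {q} {z} {x ∷ xs} (x∉xs ∷ _) (here refl) pz eq
      with p z | q z | pz | countB-cong {p} {q} xs (λ y y∈xs → eq y (All.lookup x∉xs y∈xs ∘ sym))
    ... | true  | false | refl | same rewrite same = isEven-suc (countB q xs)
    ... | false | true  | refl | same rewrite same =
      trans (sym (not-involutive _)) (cong not (sym (isEven-suc (countB q xs))))
    countB-flip {p} {q} {z} {x ∷ xs} (x∉xs ∷ uniq) (there z∈xs) pz eq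
      with p x | q x | eq x (All.lookup x∉xs z∈xs) | countB-flip {p} {q} uniq z∈xs pz eq
    ... | false | _ | refl | flipped = flipped
    ... | true  | _ | refl | flipped =
      trans (isEven-suc (countB p xs)) (trans (cong not flipped) (cong not (sym (isEven-suc (countB q xs)))))

  -- The very list that `inversions` counts over.
  pairs : ∀ n → List (Fin n × Fin n)
  pairs n = concatMap (λ i → map (i ,_) (allFin n)) (allFin n)

  pairs-unique : ∀ n → Unique (pairs n)
  pairs-unique n = subst Unique (sym (concatMap-map _,_ (allFin n) (allFin n)))
    (Uniqueₚ.cartesianProduct⁺ (Uniqueₚ.allFin⁺ n) (Uniqueₚ.allFin⁺ n))

  ∈-pairs : ∀ {n} (i j : Fin n) → (i , j) ∈ pairs n
  ∈-pairs {n} i j = subst ((i , j) ∈_) (sym (concatMap-map _,_ (allFin n) (allFin n)))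
    (∈-cartesianProduct⁺ (∈-allFin i) (∈-allFin j))

  inverted : (ℕ → ℕ) → ℕ → ℕ → Bool
  inverted f i j = ⌊ i <? j ⌋ ∧ ⌊ f j <? f i ⌋

  opaque
    evenPerm : ℕ → (ℕ → ℕ) → Bool
    evenPerm n f = isEven (countB (λ (i , j) → inverted f (toℕ i) (toℕ j)) (pairs n))

    evenPerm-cong : ∀ n {f g} → f ≗ g → evenPerm n f ≡ evenPerm n g
    evenPerm-cong n f≗g = cong isEven (countB-cong (pairs n) λ (i , j) _ →
      cong₂ (λ u v → ⌊ toℕ i <? toℕ j ⌋ ∧ ⌊ u <? v ⌋) (f≗g (toℕ j)) (f≗g (toℕ i)))

  ⌊<?⌋-true : ∀ {a b} → a < b → ⌊ a <? b ⌋ ≡ true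
  ⌊<?⌋-true {a} {b} a<b with a <? b
  ... | yes _   = refl
  ... | no a≮b  = contradiction a<b a≮b

  ⌊<?⌋-false : ∀ {a b} → ¬ a < b → ⌊ a <? b ⌋ ≡ false
  ⌊<?⌋-false {a} {b} a≮b with a <? b
  ... | yes a<b = contradiction a<b a≮b
  ... | no _    = refl

  opaque
    unfolding evenPerm

    evenPerm-id : ∀ n → evenPerm n id ≡ true
    evenPerm-id n = cong isEven (countB-none (pairs n) λ (i , j) → not-inverted (toℕ i) (toℕ j))
      where
      not-inverted : ∀ a b → inverted id a b ≡ false
      not-inverted a b with a <? b
      ... | no _    = refl
      ... | yes a<b = ⌊<?⌋-false (<-asym a<b)

  -- Transpositions flip the parity of the number of inversions.

  adjacent : ℕ → ℕ → ℕ
  adjacent k = swap k (suc k)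

  opaque
    unfolding swap

    -- The values k and k + 1 have nothing between them, so exchanging them alters no comparison
    -- except the one between the two.
    adjacent-mono : ∀ k {u v} → ¬ (u ≡ k × v ≡ suc k) → u < v → adjacent k u < adjacent k v
    adjacent-mono k {u} {v} ¬kk u<v with u ≟ k | u ≟ suc k | v ≟ k | v ≟ suc k
    ... | yes refl | _        | yes refl | _        = contradiction u<v (<-irrefl refl)
    ... | yes refl | _        | no _     | yes refl = contradiction (refl , refl) ¬kk
    ... | yes refl | _        | no _     | no v≢    = ≤∧≢⇒< u<v (v≢ ∘ sym)
    ... | no _     | yes refl | yes refl | _        = contradiction u<v (<⇒≯ (n<1+n k))
    ... | no _     | yes refl | no _     | yes refl = contradiction u<v (<-irrefl refl)
    ... | no _     | yes refl | no _     | no _     = <-trans (n<1+n k) u<v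
    ... | no _     | no _     | yes refl | _        = m<n⇒m<1+n u<v
    ... | no u≢k   | no _     | no _     | yes refl = ≤∧≢⇒< (s≤s⁻¹ u<v) u≢k
    ... | no _     | no _     | no _     | no _     = u<v

  -- `adjacent-mono` applied to the images, `adjacent k` being its own inverse; the excluded pair is
  -- therefore reversed.
  adjacent-mono⁻ : ∀ k {u v} → ¬ (u ≡ suc k × v ≡ k) → adjacent k u < adjacent k v → u < v
  adjacent-mono⁻ k {u} {v} ¬kk su<sv =
    subst₂ _<_ (swap-involutive k (suc k) u) (swap-involutive k (suc k) v)
      (adjacent-mono k (λ (su≡ , sv≡) → ¬kk
        ( trans (sym (swap-involutive k (suc k) u)) (trans (cong (adjacent k) su≡) (swap-ˡ k (suc k)))
        , trans (sym (swap-involutive k (suc k) v)) (trans (cong (adjacent k) sv≡) (swap-ʳ k (suc k)))))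
        su<sv)

  module _ {n k f} (k+1<n : suc k < n) (fP : FinPerm n f) where
    open FinPerm fP

    private
      -- The positions of the values k and k + 1. Only the pair formed by them, taken in increasing
      -- order, changes its inversion status.
      p = proj₁ (surjective k)
      q = proj₁ (surjective (suc k))
      fp≡ : f p ≡ k
      fp≡ = proj₂ (surjective k)
      fq≡ : f q ≡ suc k
      fq≡ = proj₂ (surjective (suc k))
      p<n : p < n
      p<n = reflects-< (subst (_< n) (sym fp≡) (<-trans (n<1+n k) k+1<n))
      q<n : q < n
      q<n = reflects-< (subst (_< n) (sym fq≡) k+1<n)

      sfp≡ : adjacent k (f p) ≡ suc k
      sfp≡ = trans (cong (adjacent k) fp≡) (swap-ˡ k (suc k))
      sfq≡ : adjacent k (f q) ≡ k
      sfq≡ = trans (cong (adjacent k) fq≡) (swap-ʳ k (suc k))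

      k<k+1 = n<1+n k

      is-p : ∀ {x} → f x ≡ k → x ≡ p
      is-p eq = injective (trans eq (sym fp≡))
      is-q : ∀ {x} → f x ≡ suc k → x ≡ q
      is-q eq = injective (trans eq (sym fq≡))

      at-pq : p < q → inverted (adjacent k ∘ f) p q ≡ not (inverted f p q)
      at-pq p<q rewrite ⌊<?⌋-true p<q | sfp≡ | sfq≡ | fp≡ | fq≡ =
        trans (⌊<?⌋-true k<k+1) (cong not (sym (⌊<?⌋-false (<⇒≯ k<k+1))))

      at-qp : q < p → inverted (adjacent k ∘ f) q p ≡ not (inverted f q p)
      at-qp q<p rewrite ⌊<?⌋-true q<p | sfp≡ | sfq≡ | fp≡ | fq≡ =
        trans (⌊<?⌋-false (<⇒≯ k<k+1)) (cong not (sym (⌊<?⌋-true k<k+1)))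

      elsewhere : ∀ i j → ¬ (i ≡ p × j ≡ q × p < q) → ¬ (i ≡ q × j ≡ p × q < p) →
                  inverted (adjacent k ∘ f) i j ≡ inverted f i j
      elsewhere i j ¬pq ¬qp with i <? j
      ... | no _    = refl
      ... | yes i<j with f j <? f i
      ...   | yes fj<fi = ⌊<?⌋-true (adjacent-mono k (λ (fj≡ , fi≡) →
          ¬qp (is-q fi≡ , is-p fj≡ , subst₂ _<_ (is-q fi≡) (is-p fj≡) i<j)) fj<fi)
      ...   | no fj≮fi  = ⌊<?⌋-false (fj≮fi ∘ adjacent-mono⁻ k (λ (fj≡ , fi≡) →
          ¬pq (is-p fi≡ , is-q fj≡ , subst₂ _<_ (is-p fi≡) (is-q fj≡) i<j)))

      opaque
        unfolding evenPerm

        flip-at : ∀ {a b} (a<n : a < n) (b<n : b < n) →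
                  inverted (adjacent k ∘ f) a b ≡ not (inverted f a b) →
                  (∀ i j → ¬ (i ≡ a × j ≡ b) → inverted (adjacent k ∘ f) i j ≡ inverted f i j) →
                  evenPerm n (adjacent k ∘ f) ≡ not (evenPerm n f)
        flip-at {a} {b} a<n b<n at off = countB-flip (pairs-unique n) (∈-pairs (fromℕ< a<n) (fromℕ< b<n))
          (subst₂ (λ i j → inverted (adjacent k ∘ f) i j ≡ not (inverted f i j))
            (sym (toℕ-fromℕ< a<n)) (sym (toℕ-fromℕ< b<n)) at)
          λ (i , j) ij≢ → off (toℕ i) (toℕ j) λ (i≡a , j≡b) → ij≢ (cong₂ _,_
            (toℕ-injective (trans i≡a (sym (toℕ-fromℕ< a<n))))
            (toℕ-injective (trans j≡b (sym (toℕ-fromℕ< b<n)))))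

    -- The number of inversions changes by exactly one; the case split decides in which order the
    -- two affected positions come.
    evenPerm-adjacent : evenPerm n (adjacent k ∘ f) ≡ not (evenPerm n f)
    evenPerm-adjacent with <-cmp p q
    ... | tri< p<q _ q≮p = flip-at p<n q<n (at-pq p<q) λ i j ≢pq →
      elsewhere i j (λ (i≡ , j≡ , _) → ≢pq (i≡ , j≡)) (λ (_ , _ , q<p) → q≮p q<p)
    ... | tri≈ _ p≡q _ = contradiction (trans (sym fp≡) (trans (cong f p≡q) fq≡)) (<⇒≢ k<k+1)
    ... | tri> p≮q _ q<p = flip-at q<n p<n (at-qp q<p) λ i j ≢qp →
      elsewhere i j (λ (_ , _ , p<q) → p≮q p<q) (λ (i≡ , j≡ , _) → ≢qp (i≡ , j≡))

  -- (i j+1) = s (i j) s for the adjacent transposition s = (j j+1), an odd number of flips.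
  evenPerm-swap-< : ∀ {n i j f} → i < j → j < n → FinPerm n f →
                    evenPerm n (swap i j ∘ f) ≡ not (evenPerm n f)
  evenPerm-swap-< {n} {i} {suc j} {f} i<1+j 1+j<n fP with m<1+n⇒m<n∨m≡n i<1+j
  ... | inj₂ refl = evenPerm-adjacent 1+j<n fP
  ... | inj₁ i<j  = begin
    evenPerm n (swap i (suc j) ∘ f)              ≡⟨ evenPerm-cong n factor ⟩
    evenPerm n (s ∘ swap i j ∘ s ∘ f)            ≡⟨ evenPerm-adjacent 1+j<n (swap-finPerm (<-trans i<j j<n) j<n sfP (λ _ → refl)) ⟩
    not (evenPerm n (swap i j ∘ s ∘ f))          ≡⟨ cong not (evenPerm-swap-< i<j j<n sfP) ⟩
    not (not (evenPerm n (s ∘ f)))               ≡⟨ not-involutive _ ⟩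
    evenPerm n (s ∘ f)                           ≡⟨ evenPerm-adjacent 1+j<n fP ⟩
    not (evenPerm n f)                           ∎
    where
    open ≡-Reasoning
    s = adjacent j
    j<n = <-trans (n<1+n j) 1+j<n
    sfP : FinPerm n (s ∘ f)
    sfP = swap-finPerm j<n 1+j<n fP (λ _ → refl)
    factor : swap i (suc j) ∘ f ≗ s ∘ swap i j ∘ s ∘ f
    factor x = sym (begin
      s (swap i j (s (f x)))
        ≡⟨ swap-conj (swap-injective j (suc j)) i j (s (f x)) ⟩
      swap (s i) (s j) (s (s (f x)))
        ≡⟨ cong₂ (λ u v → swap u v (s (s (f x)))) (swap-other (<⇒≢ i<j) (<⇒≢ i<1+j)) (swap-ˡ j (suc j)) ⟩
      swap i (suc j) (s (s (f x)))
        ≡⟨ cong (swap i (suc j)) (swap-involutive j (suc j) (f x)) ⟩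
      swap i (suc j) (f x) ∎)

  evenPerm-swap : ∀ {n i j f} → i ≢ j → i < n → j < n → FinPerm n f →
                  evenPerm n (swap i j ∘ f) ≡ not (evenPerm n f)
  evenPerm-swap {n} {i} {j} {f} i≢j i<n j<n fP with <-cmp i j
  ... | tri< i<j _ _ = evenPerm-swap-< i<j j<n fP
  ... | tri≈ _ i≡j _ = contradiction i≡j i≢j
  ... | tri> _ _ j<i = trans (evenPerm-cong n (λ x → swap-comm i j (f x))) (evenPerm-swap-< j<i i<n fP)

  -- Every factor flips the parity once. This ties the inversion count defining `Alt` to the number
  -- of transpositions.
  swapProduct-even : ∀ {n k f} → SwapProduct n k f → evenPerm n f ≡ isEven k
  swapProduct-even {n} (unit f≗) = trans (evenPerm-cong n f≗) (evenPerm-id n)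
  swapProduct-even {n} {suc k} (mult i≢j i<n j<n p f≗) =
    trans (evenPerm-cong n f≗)
    (trans (evenPerm-swap i≢j i<n j<n (swapProduct-finPerm p))
    (trans (cong not (swapProduct-even p)) (sym (isEven-suc k))))

  -- τ is an involution. Thus the exponent found for an even permutation may be exchanged for the
  -- weight of its code.
  τ^-parity : ∀ j k → isEven j ≡ isEven k → τ^ j ≗ τ^ k
  τ^-parity zero          zero          eq x = refl
  τ^-parity (suc zero)    (suc zero)    eq x = refl
  τ^-parity (suc (suc j)) k             eq x =
    trans (swap-involutive 0 1 (τ^ j x)) (τ^-parity j k eq x)
  τ^-parity zero          (suc (suc k)) eq x =
    trans (τ^-parity zero k eq x) (sym (swap-involutive 0 1 (τ^ k x)))
  τ^-parity (suc zero)    (suc (suc k)) eq x =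
    trans (τ^-parity 1 k eq x) (sym (swap-involutive 0 1 (τ^ k x)))

  -- Even permutations and their codes

  infix 4 _represents_

  record _represents_ {n} (v : Perm n) (f : ℕ → ℕ) : Set where
    constructor represent
    field at : ∀ i → toℕ (lookup v i) ≡ f (toℕ i)
  open _represents_

  represents-≡ : ∀ {n} {u v : Perm n} {f g} → u represents f → v represents g →
                 (∀ {x} → x < n → f x ≡ g x) → u ≡ v
  represents-≡ {n} {u} {v} uf vg f≡g = begin
    u                    ≡⟨ tabulate∘lookup u ⟨
    tabulate (lookup u)  ≡⟨ tabulate-cong (λ i → toℕ-injective (trans (at uf i) (trans (f≡g (toℕ<n i)) (sym (at vg i))))) ⟩
    tabulate (lookup v)  ≡⟨ tabulate∘lookup v ⟩
    v                    ∎
    where open ≡-Reasoning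

  represents-cong : ∀ {n} {v : Perm n} {f g} → v represents f → f ≗ g → v represents g
  represents-cong vf f≗g = represent λ i → trans (at vf i) (f≗g (toℕ i))

  idP-represents : ∀ n → idP n represents id
  idP-represents n = represent λ i → cong toℕ (lookup∘tabulate id i)

  ∘P-represents : ∀ {n} {u v : Perm n} {f g} → u represents f → v represents g → u ∘P v represents f ∘ g
  ∘P-represents {v = v} {f} uf vg = represent λ i →
    trans (cong toℕ (lookup∘tabulate _ i)) (trans (at uf (lookup v i)) (cong f (at vg i)))

  transp-represents : ∀ {n} (a b : Fin n) → transp a b represents swap (toℕ a) (toℕ b)
  transp-represents a b = represent at-swap
    where
    at-swap : ∀ i → toℕ (lookup (transp a b) i) ≡ swap (toℕ a) (toℕ b) (toℕ i)
    at-swap i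
      rewrite (lookup (transp a b) i ≡ _) ∋ lookup∘tabulate _ i
      with i ≟F a | i ≟F b
    ... | yes refl | _        = sym (swap-ˡ (toℕ i) (toℕ b))
    ... | no _     | yes refl = sym (swap-ʳ (toℕ a) (toℕ i))
    ... | no i≢a   | no i≢b   = sym (swap-other (i≢a ∘ toℕ-injective) (i≢b ∘ toℕ-injective))

  -- Words in the generators and products of transpositions.

  gen-represents : ∀ m i j → gen m i j represents τ ∘ swap (toℕ i) (toℕ j)
  gen-represents m i j = ∘P-represents (transp-represents zero (suc zero)) (transp-represents i j)

  -- Since the generators are τ(i j), moving all factors τ to the right turns a product of
  -- k generators into a product of k transpositions times τ^k.
  word⇒swapProduct : ∀ {m} w → ∃[ f ] SwapProduct (2 + m) (length w) f × prodWord m w represents f ∘ τ^ (length w)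
  word⇒swapProduct {m} [] = id , unit (λ _ → refl) , idP-represents (2 + m)
  word⇒swapProduct {m} ((i , j , i<j) ∷ w) =
    let f , p , rep = word⇒swapProduct w in
    swap (τ (toℕ i)) (τ (toℕ j)) ∘ τ ∘ f ∘ τ ,
    mult (<⇒≢ i<j ∘ swap-injective 0 1) (τ-< (toℕ<n i)) (τ-< (toℕ<n j)) (swapProduct-conj p) (λ _ → refl) ,
    represents-cong (∘P-represents (gen-represents m i j) rep) λ x →
      trans (swap-conj (swap-injective 0 1) (toℕ i) (toℕ j) _)
            (cong (swap (τ (toℕ i)) (τ (toℕ j)) ∘ τ ∘ f) (sym (swap-involutive 0 1 _)))

  -- `GenIdx` holds increasing pairs only, so the two points are put in order.
  transposition : ∀ {n i j} → i ≢ j → i < n → j < n →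
                  Σ (GenIdx n) λ (a , b , _) → swap i j ≗ swap (toℕ a) (toℕ b)
  transposition {i = i} {j} i≢j i<n j<n with <-cmp i j
  ... | tri< i<j _ _ =
    (fromℕ< i<n , fromℕ< j<n , subst₂ _<_ (sym (toℕ-fromℕ< i<n)) (sym (toℕ-fromℕ< j<n)) i<j) ,
    λ x → cong₂ (λ a b → swap a b x) (sym (toℕ-fromℕ< i<n)) (sym (toℕ-fromℕ< j<n))
  ... | tri≈ _ i≡j _ = contradiction i≡j i≢j
  ... | tri> _ _ j<i =
    (fromℕ< j<n , fromℕ< i<n , subst₂ _<_ (sym (toℕ-fromℕ< j<n)) (sym (toℕ-fromℕ< i<n)) j<i) ,
    λ x → trans (swap-comm i j x)
                (cong₂ (λ a b → swap a b x) (sym (toℕ-fromℕ< j<n)) (sym (toℕ-fromℕ< i<n)))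

  -- By (i j) g = τ (τ i τ j) (τ g τ) τ, the first generator is τ (τ i τ j) and the rest of the word
  -- comes from τ g τ. The induction runs on k, as the product for τ g τ is not a subterm of the
  -- given one.
  swapProduct⇒word : ∀ {m k f} → SwapProduct (2 + m) k f →
                     ∃[ w ] length w ≡ k × prodWord m w represents f ∘ τ^ k
  swapProduct⇒word {m} {zero} (unit f≗) =
    [] , refl , represents-cong (idP-represents (2 + m)) (sym ∘ f≗)
  swapProduct⇒word {m} {suc k} {f} (mult {g = g} {i} {j} i≢j i<n j<n p f≗) =
    let (a , b , a<b) , eq = transposition (i≢j ∘ swap-injective 0 1) (τ-< i<n) (τ-< j<n)
        w , len , rep = swapProduct⇒word (swapProduct-conj p)
    in (a , b , a<b) ∷ w , cong suc len ,
       represents-cong (∘P-represents (gen-represents m a b) rep) λ x → begin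
         τ (swap (toℕ a) (toℕ b) (τ (g (τ (τ^ k x)))))
           ≡⟨ cong τ (eq _) ⟨
         τ (swap (τ i) (τ j) (τ (g (τ (τ^ k x)))))
           ≡⟨ cong τ (swap-conj (swap-injective 0 1) i j _) ⟨
         τ (τ (swap i j (g (τ (τ^ k x)))))
           ≡⟨ swap-involutive 0 1 _ ⟩
         swap i j (g (τ (τ^ k x)))
           ≡⟨ f≗ _ ⟨
         f (τ (τ^ k x)) ∎
    where open ≡-Reasoning

  -- Tables, functions and membership in `Alt`.

  fromFunction : ∀ {n f} → FinPerm n f → Perm n
  fromFunction fP = tabulate λ i → fromℕ< (FinPerm.preserves-< fP (toℕ<n i))

  fromFunction-represents : ∀ {n f} (fP : FinPerm n f) → fromFunction fP represents f
  fromFunction-represents fP = represent λ i → trans (cong toℕ (lookup∘tabulate _ i)) (toℕ-fromℕ< _)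

  toFunction : ∀ {n} → Perm n → ℕ → ℕ
  toFunction {n} v x with x <? n
  ... | yes x<n = toℕ (lookup v (fromℕ< x<n))
  ... | no _    = x

  toFunction-< : ∀ {n} (v : Perm n) {x} (x<n : x < n) → toFunction v x ≡ toℕ (lookup v (fromℕ< x<n))
  toFunction-< {n} v {x} x<n with x <? n
  ... | yes _  = refl
  ... | no x≮n = contradiction x<n x≮n

  toFunction-represents : ∀ {n} (v : Perm n) → v represents toFunction v
  toFunction-represents v = represent λ i →
    sym (trans (toFunction-< v (toℕ<n i)) (cong (toℕ ∘ lookup v) (fromℕ<-toℕ i (toℕ<n i))))

  opaque
    unfolding evenPerm

    inversions-represents : ∀ {n} {v : Perm n} {f} → v represents f → isEven (inversions v) ≡ evenPerm n f
    inversions-represents {n} vf = cong isEven (countB-cong (pairs n) λ (i , j) _ →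
      cong₂ (λ a b → ⌊ toℕ i <? toℕ j ⌋ ∧ ⌊ a <? b ⌋) (at vf j) (at vf i))

  allB⁺ : ∀ {A : Set} {p : A → Bool} xs → (∀ x → p x ≡ true) → allB p xs ≡ true
  allB⁺ []       all = refl
  allB⁺ (x ∷ xs) all rewrite all x = allB⁺ xs all

  ∧-true : ∀ {a b} → a ∧ b ≡ true → a ≡ true × b ≡ true
  ∧-true {true} {true} _ = refl , refl

  allB⁻ : ∀ {A : Set} {p : A → Bool} {x xs} → allB p xs ≡ true → x ∈ xs → p x ≡ true
  allB⁻ all (here refl)  = proj₁ (∧-true all)
  allB⁻ all (there x∈xs) = allB⁻ (proj₂ (∧-true all)) x∈xs

  isPerm⁺ : ∀ {n} (v : Perm n) → (∀ i j → lookup v i ≡ lookup v j → i ≡ j) → isPerm v ≡ true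
  isPerm⁺ {n} v inj = allB⁺ (allFin n) λ i → allB⁺ (allFin n) λ j → pair i j
    where
    pair : ∀ i j → ⌊ i ≟F j ⌋ ∨ not ⌊ lookup v i ≟F lookup v j ⌋ ≡ true
    pair i j with i ≟F j | lookup v i ≟F lookup v j
    ... | yes _  | _      = refl
    ... | no _   | no _   = refl
    ... | no i≢j | yes eq = contradiction (inj i j eq) i≢j

  isPerm⁻ : ∀ {n} (v : Perm n) → isPerm v ≡ true → ∀ i j → lookup v i ≡ lookup v j → i ≡ j
  isPerm⁻ v perm i j eq with i ≟F j | lookup v i ≟F lookup v j | allB⁻ (allB⁻ perm (∈-allFin i)) (∈-allFin j)
  ... | yes i≡j | _       | _ = i≡j
  ... | no _    | no ≢    | _ = contradiction eq ≢

  allVecs-product : ∀ n k → allVecs n (suc k) ≡ cartesianProductWith _∷_ (allFin n) (allVecs n k)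
  allVecs-product n k = concatMap-map _∷_ (allFin n) (allVecs n k)

  ∈-allVecs : ∀ {n k} (v : Vec (Fin n) k) → v ∈ allVecs n k
  ∈-allVecs []      = here refl
  ∈-allVecs {n} {suc k} (x ∷ v) = subst (x ∷ v ∈_) (sym (allVecs-product n k))
    (∈-cartesianProductWith⁺ _∷_ (∈-allFin x) (∈-allVecs v))

  allVecs-unique : ∀ n k → Unique (allVecs n k)
  allVecs-unique n zero    = All.[] ∷ []
  allVecs-unique n (suc k) = subst Unique (sym (allVecs-product n k))
    (Uniqueₚ.cartesianProductWith⁺ _∷_ ∷-injective (Uniqueₚ.allFin⁺ n) (allVecs-unique n k))

  ∈-Alt⁺ : ∀ {n} {v : Perm n} {f} → FinPerm n f → v represents f → evenPerm n f ≡ true → v ∈ Alt n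
  ∈-Alt⁺ {n} {v} fP vf even = ∈-filter⁺ (λ σ → (isPerm σ ∧ isEven (inversions σ)) ≟B true) (∈-allVecs v)
    (cong₂ _∧_
      (isPerm⁺ v λ i j eq → toℕ-injective (FinPerm.injective fP
        (trans (sym (at vf i)) (trans (cong toℕ eq) (at vf j)))))
      (trans (inversions-represents vf) even))

  ∈-Alt⁻ : ∀ {n} {v : Perm n} → v ∈ Alt n → isPerm v ≡ true × isEven (inversions v) ≡ true
  ∈-Alt⁻ {n} v∈ = ∧-true (proj₂ (∈-filter⁻ (λ σ → (isPerm σ ∧ isEven (inversions σ)) ≟B true) {xs = allVecs n n} v∈))

  Alt-unique : ∀ n → Unique (Alt n)
  Alt-unique n = Uniqueₚ.filter⁺ (λ σ → (isPerm σ ∧ isEven (inversions σ)) ≟B true) (allVecs-unique n n)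

  -- The even permutation of a code and its length.

  -- With this exponent the number of transpositions is twice the weight, so the result is even; it
  -- is also the shape of a product of `weight c` generators.
  codeFunction : ∀ {m} → Code m → ℕ → ℕ
  codeFunction c = ⟦ c ⟧ ∘ τ^ (weight c)

  codeFunction-swapProduct : ∀ {m} (c : Code m) → SwapProduct (2 + m) (weight c + weight c) (codeFunction c)
  codeFunction-swapProduct c = swapProduct-∘ (⟦⟧-swapProduct c) (τ^-swapProduct (weight c))

  codePerm : ∀ {m} → Code m → Perm (2 + m)
  codePerm c = fromFunction (swapProduct-finPerm (codeFunction-swapProduct c))

  codePerm-represents : ∀ {m} (c : Code m) → codePerm c represents codeFunction c
  codePerm-represents c = fromFunction-represents (swapProduct-finPerm (codeFunction-swapProduct c))

  represents-agree : ∀ {n} {v : Perm n} {f g} → v represents f → v represents g → ∀ {x} → x < n → f x ≡ g x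
  represents-agree {f = f} {g} vf vg x<n =
    subst (λ x → f x ≡ g x) (toℕ-fromℕ< x<n) (trans (sym (at vf (fromℕ< x<n))) (at vg (fromℕ< x<n)))

  codePerm-injective : ∀ {m} {c c′ : Code m} → codePerm c ≡ codePerm c′ → c ≡ c′
  codePerm-injective {c = c} {c′} eq = ⟦⟧-unique c c′ (weight c) (weight c′)
    (represents-agree (codePerm-represents c) (subst (_represents codeFunction c′) (sym eq) (codePerm-represents c′)))

  codePerm∈Alt : ∀ {m} (c : Code m) → codePerm c ∈ Alt (2 + m)
  codePerm∈Alt c = ∈-Alt⁺ (swapProduct-finPerm p) (codePerm-represents c)
    (trans (swapProduct-even p) (isEven-n+n (weight c)))
    where p = codeFunction-swapProduct c

  Alt⇒codePerm : ∀ {m} {v : Perm (2 + m)} → v ∈ Alt (2 + m) → ∃[ c ] v ≡ codePerm {m} c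
  Alt⇒codePerm {m} {v} v∈ =
    let perm , even = ∈-Alt⁻ v∈
        c , e , eq = decompose m (toFunction v)
          (λ x<n → subst (_< 2 + m) (sym (toFunction-< v x<n)) (toℕ<n _))
          (λ x<n y<n fx≡fy → trans (sym (toℕ-fromℕ< x<n)) (trans (cong toℕ
            (isPerm⁻ v perm (fromℕ< x<n) (fromℕ< y<n) (toℕ-injective
              (trans (sym (toFunction-< v x<n)) (trans fx≡fy (toFunction-< v y<n))))))
            (toℕ-fromℕ< y<n)))
        rep : v represents ⟦ c ⟧ ∘ τ^ e
        rep = represent λ i → trans (at (toFunction-represents v) i) (eq (toℕ<n i))
        -- `v` is a product of `weight c + e` transpositions; since it is even, `e` and `weight c`
        -- have equal parity.
        parity = isEven-+ (weight c) e
          (trans (sym (swapProduct-even (swapProduct-∘ (⟦⟧-swapProduct c) (τ^-swapProduct e))))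
          (trans (sym (inversions-represents rep)) even))
    in c , represents-≡ rep (codePerm-represents c)
             (λ {x} _ → cong ⟦ c ⟧ (τ^-parity e (weight c) (sym parity) x))

  -- The factors of the code themselves give a word of length `weight c`. Conversely, a word of
  -- length k yields a code of weight at most k in the same coset modulo τ, and by uniqueness that
  -- code is `c`.
  codePerm-length : ∀ {m} (c : Code m) → IsLengthOf m (weight c) (codePerm c)
  codePerm-length {m} c = shortest , minimal
    where
    shortest : IsProdOf m (weight c) (codePerm c)
    shortest = let w , len , rep = swapProduct⇒word (⟦⟧-swapProduct c) in
      w , len , represents-≡ rep (codePerm-represents c) (λ _ → refl)

    minimal : ∀ k → IsProdOf m k (codePerm c) → weight c ≤ k
    minimal k (w , refl , eq) =
      let f , p , rep = word⇒swapProduct w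
          c′ , e , w≤ , f≗ = swapProduct⇒code p
          c≡c′ = ⟦⟧-unique c c′ (weight c) (e + length w)
            (represents-agree (codePerm-represents c)
              (subst (_represents ⟦ c′ ⟧ ∘ τ^ (e + length w)) eq
                (represents-cong rep λ x →
                  trans (f≗ _) (cong ⟦ c′ ⟧ (sym (τ^-+ e (length w) x))))))
      in subst (λ d → weight d ≤ length w) (sym c≡c′) w≤

  -- Enumeration of the alternating group by codes.

  codes : ∀ m → List (Code m)
  codes zero    = ε ∷ []
  codes (suc m) = map stay (codes m) ++ cartesianProductWith move (allFin (2 + m)) (codes m)

  ∈-codes : ∀ {m} (c : Code m) → c ∈ codes m
  ∈-codes ε          = here refl
  ∈-codes (stay c)   = ∈-++⁺ˡ (∈-map⁺ stay (∈-codes c))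
  ∈-codes {suc m} (move a c) = ∈-++⁺ʳ (map stay (codes m)) (∈-cartesianProductWith⁺ move (∈-allFin a) (∈-codes c))

  codes-unique : ∀ m → Unique (codes m)
  codes-unique zero    = All.[] ∷ []
  codes-unique (suc m) = Uniqueₚ.++⁺
    (Uniqueₚ.map⁺ (λ { refl → refl }) (codes-unique m))
    (Uniqueₚ.cartesianProductWith⁺ move (λ { refl → refl , refl }) (Uniqueₚ.allFin⁺ (2 + m)) (codes-unique m))
    disjoint
    where
    disjoint : ∀ {c} → ¬ (c ∈ map stay (codes m) × c ∈ cartesianProductWith move (allFin (2 + m)) (codes m))
    disjoint (c∈ , c∈′)
      with ∈-map⁻ stay c∈ | ∈-cartesianProductWith⁻ move (allFin (2 + m)) (codes m) c∈′
    ... | _ , _ , refl | _ , _ , _ , _ , ()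

  -- Neither list has repetitions and both have the same members. Sums over the group thereby become
  -- sums over codes.
  Alt↭codes : ∀ m → Alt (2 + m) ↭ map codePerm (codes m)
  Alt↭codes m = ∼bag⇒↭ (unique∧set⇒bag (Alt-unique (2 + m)) (Uniqueₚ.map⁺ codePerm-injective (codes-unique m))
    (mk⇔ to from))
    where
    to : ∀ {v} → v ∈ Alt (2 + m) → v ∈ map codePerm (codes m)
    to v∈ = let c , v≡ = Alt⇒codePerm v∈ in
      subst (_∈ map codePerm (codes m)) (sym v≡) (∈-map⁺ codePerm (∈-codes c))
    from : ∀ {v} → v ∈ map codePerm (codes m) → v ∈ Alt (2 + m)
    from v∈ = let c , _ , v≡ = ∈-map⁻ codePerm v∈ in
      subst (_∈ Alt (2 + m)) (sym v≡) (codePerm∈Alt c)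

open import Data.Rational using (_+_; _*_)
open +-*-Solver using (solve; _:=_; _:+_; _:*_; _:-_; con)

-- Moments

fromℚᵘ-homo-+ : ∀ p q → fromℚᵘ (p ℚᵘ.+ q) ≡ fromℚᵘ p + fromℚᵘ q
fromℚᵘ-homo-+ p q = toℚᵘ-injective (begin-equality
  toℚᵘ (fromℚᵘ (p ℚᵘ.+ q))                ≃⟨ toℚᵘ-fromℚᵘ (p ℚᵘ.+ q) ⟩
  p ℚᵘ.+ q                                ≃⟨ ℚᵘₚ.+-cong (toℚᵘ-fromℚᵘ p) (toℚᵘ-fromℚᵘ q) ⟨
  toℚᵘ (fromℚᵘ p) ℚᵘ.+ toℚᵘ (fromℚᵘ q)    ≃⟨ toℚᵘ-homo-+ (fromℚᵘ p) (fromℚᵘ q) ⟨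
  toℚᵘ (fromℚᵘ p + fromℚᵘ q)              ∎)
  where open ℚᵘₚ.≤-Reasoning

fromℚᵘ-homo-* : ∀ p q → fromℚᵘ (p ℚᵘ.* q) ≡ fromℚᵘ p * fromℚᵘ q
fromℚᵘ-homo-* p q = toℚᵘ-injective (begin-equality
  toℚᵘ (fromℚᵘ (p ℚᵘ.* q))                ≃⟨ toℚᵘ-fromℚᵘ (p ℚᵘ.* q) ⟩
  p ℚᵘ.* q                                ≃⟨ ℚᵘₚ.*-cong (toℚᵘ-fromℚᵘ p) (toℚᵘ-fromℚᵘ q) ⟨
  toℚᵘ (fromℚᵘ p) ℚᵘ.* toℚᵘ (fromℚᵘ q)    ≃⟨ toℚᵘ-homo-* (fromℚᵘ p) (fromℚᵘ q) ⟨
  toℚᵘ (fromℚᵘ p * fromℚᵘ q)              ∎)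
  where open ℚᵘₚ.≤-Reasoning

ℕ→ℚ-suc : ∀ k → ℕ→ℚ (suc k) ≡ 1ℚ + ℕ→ℚ k
ℕ→ℚ-suc k = trans
  (fromℚᵘ-cong {ℚᵘ.mkℚᵘ (+ suc k) 0} {ℚᵘ.1ℚᵘ ℚᵘ.+ ℚᵘ.mkℚᵘ (+ k) 0}
    (ℚᵘ.*≡* (cong (λ z → (+ 1 ℤ.+ z) ℤ.* + 1) (sym (ℤₚ.*-identityʳ (+ k))))))
  (fromℚᵘ-homo-+ ℚᵘ.1ℚᵘ (ℚᵘ.mkℚᵘ (+ k) 0))

1/suc-inverse : ∀ k → (+ 1) / suc k * ℕ→ℚ (suc k) ≡ 1ℚ
1/suc-inverse k = trans
  (sym (fromℚᵘ-homo-* (ℚᵘ.mkℚᵘ (+ 1) k) (ℚᵘ.mkℚᵘ (+ suc k) 0)))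
  (fromℚᵘ-cong {ℚᵘ.mkℚᵘ (+ 1) k ℚᵘ.* ℚᵘ.mkℚᵘ (+ suc k) 0} {ℚᵘ.1ℚᵘ}
    (ℚᵘ.*≡* (cong (+_) (trans (ℕₚ.*-identityʳ (suc k ℕ.+ 0)) (trans (ℕₚ.+-identityʳ (suc k))
      (sym (trans (ℕₚ.+-identityʳ (suc k ℕ.* 1)) (ℕₚ.*-identityʳ (suc k)))))))))

1/suc-square : ∀ k → (+ 1) / (suc k ℕ.* suc k) ≡ (+ 1) / suc k * ((+ 1) / suc k)
1/suc-square k = fromℚᵘ-homo-* (ℚᵘ.mkℚᵘ (+ 1) k) (ℚᵘ.mkℚᵘ (+ 1) k)

-- Finite sums and expectations.

module _ {A : Set} where

  sumℚ-cong : ∀ {f g : A → ℚ} xs → (∀ {x} → x ∈ xs → f x ≡ g x) → sumℚ f xs ≡ sumℚ g xs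
  sumℚ-cong []       eq = refl
  sumℚ-cong (x ∷ xs) eq = cong₂ _+_ (eq (here refl)) (sumℚ-cong xs (eq ∘ there))

  sumℚ-++ : ∀ (f : A → ℚ) xs ys → sumℚ f (xs ++ ys) ≡ sumℚ f xs + sumℚ f ys
  sumℚ-++ f []       ys = sym (+-identityˡ _)
  sumℚ-++ f (x ∷ xs) ys = trans (cong (_+_ (f x)) (sumℚ-++ f xs ys)) (sym (+-assoc (f x) _ _))

  sumℚ-+ : ∀ (f g : A → ℚ) xs → sumℚ (λ x → f x + g x) xs ≡ sumℚ f xs + sumℚ g xs
  sumℚ-+ f g []       = refl
  sumℚ-+ f g (x ∷ xs) = trans (cong (_+_ (f x + g x)) (sumℚ-+ f g xs))
    (solve 4 (λ a b s t → a :+ b :+ (s :+ t) := a :+ s :+ (b :+ t)) refl (f x) (g x) (sumℚ f xs) (sumℚ g xs))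

  sumℚ-↭ : ∀ (f : A → ℚ) {xs ys} → xs ↭ ys → sumℚ f xs ≡ sumℚ f ys
  sumℚ-↭ f ↭.refl         = refl
  sumℚ-↭ f (↭.prep x p)   = cong (_+_ (f x)) (sumℚ-↭ f p)
  sumℚ-↭ f (↭.swap {ys = ys} x y p) = trans (cong (λ s → f x + (f y + s)) (sumℚ-↭ f p))
    (solve 3 (λ a b s → a :+ (b :+ s) := b :+ (a :+ s)) refl (f x) (f y) (sumℚ f ys))
  sumℚ-↭ f (↭.trans p q)  = trans (sumℚ-↭ f p) (sumℚ-↭ f q)

  sumℚ-1 : ∀ (xs : List A) → sumℚ (const 1ℚ) xs ≡ ℕ→ℚ (length xs)
  sumℚ-1 []       = refl
  sumℚ-1 (x ∷ xs) = trans (cong (_+_ 1ℚ) (sumℚ-1 xs)) (sym (ℕ→ℚ-suc (length xs)))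

  -- The defining equation of a mean with the division cleared, the size of the list being written
  -- as a sum of ones. The member `x` rules out the empty list, on which `E` has a default value.
  E-unique : ∀ {f : A → ℚ} {e} {xs} {x} → x ∈ xs → sumℚ f xs ≡ e * sumℚ (const 1ℚ) xs → E xs f ≡ e
  E-unique {f} {e} {xs@(_ ∷ ys)} _ eq = begin
    sumℚ f xs * r                     ≡⟨ cong (_* r) eq ⟩
    e * sumℚ (const 1ℚ) xs * r        ≡⟨ cong (λ s → e * s * r) (sumℚ-1 xs) ⟩
    e * ℕ→ℚ (length xs) * r           ≡⟨ solve 3 (λ e n r → e :* n :* r := e :* (r :* n)) refl e (ℕ→ℚ (length xs)) r ⟩
    e * (r * ℕ→ℚ (length xs))         ≡⟨ cong (e *_) (1/suc-inverse (length ys)) ⟩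
    e * 1ℚ                            ≡⟨ *-identityʳ e ⟩
    e                                 ∎
    where
    open ≡-Reasoning
    r = (+ 1) / length xs

sumℚ-map : ∀ {A B : Set} (f : B → ℚ) (g : A → B) xs → sumℚ f (map g xs) ≡ sumℚ (f ∘ g) xs
sumℚ-map f g []       = refl
sumℚ-map f g (x ∷ xs) = cong (_+_ (f (g x))) (sumℚ-map f g xs)

-- For summands independent of the first argument, as the increase in weight under `move a` is
-- independent of `a`.
sumℚ-cartesianProductWith : ∀ {A B C : Set} (f : C → ℚ) (g : A → B → C) {h : B → ℚ} xs ys →
  (∀ x y → f (g x y) ≡ h y) → sumℚ f (cartesianProductWith g xs ys) ≡ ℕ→ℚ (length xs) * sumℚ h ys
sumℚ-cartesianProductWith f g {h} []       ys eq = sym (*-zeroˡ (sumℚ h ys))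
sumℚ-cartesianProductWith f g {h} (x ∷ xs) ys eq = begin
  sumℚ f (map (g x) ys ++ cartesianProductWith g xs ys)
    ≡⟨ sumℚ-++ f (map (g x) ys) _ ⟩
  sumℚ f (map (g x) ys) + sumℚ f (cartesianProductWith g xs ys)
    ≡⟨ cong₂ _+_ (trans (sumℚ-map f (g x) ys) (sumℚ-cong ys (λ {y} _ → eq x y)))
                 (sumℚ-cartesianProductWith f g xs ys eq) ⟩
  sumℚ h ys + ℕ→ℚ (length xs) * sumℚ h ys
    ≡⟨ solve 2 (λ s n → s :+ n :* s := (con 1ℚ :+ n) :* s) refl (sumℚ h ys) (ℕ→ℚ (length xs)) ⟩
  (1ℚ + ℕ→ℚ (length xs)) * sumℚ h ys
    ≡⟨ cong (_* sumℚ h ys) (ℕ→ℚ-suc (length xs)) ⟨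
  ℕ→ℚ (suc (length xs)) * sumℚ h ys ∎
  where open ≡-Reasoning

-- Power sums of the weight over all codes.

codeSum : ℕ → (ℕ → ℚ) → ℚ
codeSum m F = sumℚ (F ∘ weight) (codes m)

-- The new choice is trivial in one way and nontrivial in `2 + m` ways, each adding 1 to the weight.
-- In terms of generating polynomials this is multiplication by 1 + (2 + m) t.
codeSum-suc : ∀ m F → codeSum (suc m) F ≡ codeSum m F + ℕ→ℚ (2 ℕ.+ m) * codeSum m (F ∘ suc)
codeSum-suc m F = begin
  sumℚ (F ∘ weight) (map stay (codes m) ++ cartesianProductWith move (allFin (2 ℕ.+ m)) (codes m))
    ≡⟨ sumℚ-++ (F ∘ weight) (map stay (codes m)) _ ⟩
  sumℚ (F ∘ weight) (map stay (codes m)) + sumℚ (F ∘ weight) (cartesianProductWith move (allFin (2 ℕ.+ m)) (codes m))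
    ≡⟨ cong₂ _+_ (sumℚ-map (F ∘ weight) stay (codes m))
         (sumℚ-cartesianProductWith (F ∘ weight) move (allFin (2 ℕ.+ m)) (codes m) (λ _ _ → refl)) ⟩
  codeSum m F + ℕ→ℚ (length (allFin (2 ℕ.+ m))) * codeSum m (F ∘ suc)
    ≡⟨ cong (λ n → codeSum m F + ℕ→ℚ n * codeSum m (F ∘ suc)) (length-tabulate {n = 2 ℕ.+ m} id) ⟩
  codeSum m F + ℕ→ℚ (2 ℕ.+ m) * codeSum m (F ∘ suc) ∎
  where open ≡-Reasoning

codeSum-cong : ∀ m {F G} → F ≗ G → codeSum m F ≡ codeSum m G
codeSum-cong m F≗G = sumℚ-cong (codes m) (λ {c} _ → F≗G (weight c))

codeSum-+ : ∀ m F G → codeSum m (λ k → F k + G k) ≡ codeSum m F + codeSum m G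
codeSum-+ m F G = sumℚ-+ (F ∘ weight) (G ∘ weight) (codes m)

-- The moments before division by the number of codes, which keeps their recursions free of
-- fractions.
count first second : ℕ → ℚ
count  m = codeSum m (const 1ℚ)
first  m = codeSum m ℕ→ℚ
second m = codeSum m (λ k → ℕ→ℚ k * ℕ→ℚ k)

count-suc : ∀ m → count (suc m) ≡ (1ℚ + ℕ→ℚ (2 ℕ.+ m)) * count m
count-suc m = trans (codeSum-suc m (const 1ℚ))
  (solve 2 (λ s q → s :+ q :* s := (con 1ℚ :+ q) :* s) refl (count m) (ℕ→ℚ (2 ℕ.+ m)))

first-suc : ∀ m → first (suc m) ≡ first m + ℕ→ℚ (2 ℕ.+ m) * (count m + first m)
first-suc m = trans (codeSum-suc m ℕ→ℚ)
  (cong (λ s → first m + ℕ→ℚ (2 ℕ.+ m) * s)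
    (trans (codeSum-cong m ℕ→ℚ-suc) (codeSum-+ m (const 1ℚ) ℕ→ℚ)))

second-suc : ∀ m → second (suc m) ≡ second m + ℕ→ℚ (2 ℕ.+ m) * (count m + (first m + first m + second m))
second-suc m = trans (codeSum-suc m (λ k → ℕ→ℚ k * ℕ→ℚ k))
  (cong (λ s → second m + ℕ→ℚ (2 ℕ.+ m) * s)
    (trans (codeSum-cong m square-suc)
    (trans (codeSum-+ m (const 1ℚ) (λ k → ℕ→ℚ k + ℕ→ℚ k + ℕ→ℚ k * ℕ→ℚ k))
    (cong (_+_ (count m))
      (trans (codeSum-+ m (λ k → ℕ→ℚ k + ℕ→ℚ k) (λ k → ℕ→ℚ k * ℕ→ℚ k)) (cong (_+ second m) (codeSum-+ m ℕ→ℚ ℕ→ℚ)))))))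
  where
  square-suc : ∀ k → ℕ→ℚ (suc k) * ℕ→ℚ (suc k) ≡ 1ℚ + (ℕ→ℚ k + ℕ→ℚ k + ℕ→ℚ k * ℕ→ℚ k)
  square-suc k = trans (cong₂ _*_ (ℕ→ℚ-suc k) (ℕ→ℚ-suc k))
    (solve 1 (λ x → (con 1ℚ :+ x) :* (con 1ℚ :+ x) := con 1ℚ :+ (x :+ x :+ x :* x)) refl (ℕ→ℚ k))

-- Closed forms of the moments.

mean variance : ℕ → ℚ
mean m     = ℕ→ℚ (2 ℕ.+ m) - H (2 ℕ.+ m) - (+ 1) / 2
variance m = H (2 ℕ.+ m) - H2 (2 ℕ.+ m) - (+ 1) / 4

-- The new Bernoulli factor has success probability 1 - 1/n.
mean-suc : ∀ m → mean (suc m) ≡ mean m + (1ℚ - (+ 1) / (3 ℕ.+ m))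
mean-suc m = trans
  (cong (λ n → n - H (3 ℕ.+ m) - (+ 1) / 2) (ℕ→ℚ-suc (2 ℕ.+ m)))
  (solve 4 (λ n h r c → con 1ℚ :+ n :- (h :+ r) :- c := n :- h :- c :+ (con 1ℚ :- r)) refl
    (ℕ→ℚ (2 ℕ.+ m)) (H (2 ℕ.+ m)) ((+ 1) / (3 ℕ.+ m)) ((+ 1) / 2))

-- With r = 1/(3 + m), the increment r - r² is the variance r (1 - r) of the new Bernoulli variable.
variance-suc : ∀ m → variance (suc m) ≡ variance m + ((+ 1) / (3 ℕ.+ m) - (+ 1) / (3 ℕ.+ m) * ((+ 1) / (3 ℕ.+ m)))
variance-suc m = trans
  (cong (λ s → H (3 ℕ.+ m) - (H2 (2 ℕ.+ m) + s) - (+ 1) / 4) (1/suc-square (2 ℕ.+ m)))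
  (solve 4 (λ h g r c → h :+ r :- (g :+ r :* r) :- c := h :- g :- c :+ (r :- r :* r)) refl
    (H (2 ℕ.+ m)) (H2 (2 ℕ.+ m)) ((+ 1) / (3 ℕ.+ m)) ((+ 1) / 4))

module _ (r q : ℚ) (rq≡1 : r * (1ℚ + q) ≡ 1ℚ) where
  open ≡-Reasoning

  -- Here `q` counts the nontrivial choices of the new factor and `r` is the probability of the
  -- trivial one. A single 1 is isolated and replaced by r (1 + q), after which 1 + q factors out.
  mean-step : ∀ μ s → μ * s + q * (s + μ * s) ≡ (μ + (1ℚ - r)) * ((1ℚ + q) * s)
  mean-step μ s = begin
    μ * s + q * (s + μ * s)
      ≡⟨ solve 3 (λ μ s q → μ :* s :+ q :* (s :+ μ :* s) := ((μ :+ con 1ℚ) :* (con 1ℚ :+ q) :- con 1ℚ) :* s) refl μ s q ⟩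
    ((μ + 1ℚ) * (1ℚ + q) - 1ℚ) * s
      ≡⟨ cong (λ z → ((μ + 1ℚ) * (1ℚ + q) - z) * s) rq≡1 ⟨
    ((μ + 1ℚ) * (1ℚ + q) - r * (1ℚ + q)) * s
      ≡⟨ solve 4 (λ μ s q r → ((μ :+ con 1ℚ) :* (con 1ℚ :+ q) :- r :* (con 1ℚ :+ q)) :* s := (μ :+ (con 1ℚ :- r)) :* ((con 1ℚ :+ q) :* s)) refl μ s q r ⟩
    (μ + (1ℚ - r)) * ((1ℚ + q) * s) ∎

  -- The second moment is carried as variance plus squared mean, so that both update separately. The
  -- isolated 1 now has the coefficient 1 + 2μ.
  second-step : ∀ V μ s →
    (V + μ * μ) * s + q * (s + (μ * s + μ * s + (V + μ * μ) * s)) ≡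
    (V + (r - r * r) + (μ + (1ℚ - r)) * (μ + (1ℚ - r))) * ((1ℚ + q) * s)
  second-step V μ s = begin
    (V + μ * μ) * s + q * (s + (μ * s + μ * s + (V + μ * μ) * s))
      ≡⟨ solve 4 (λ V μ s q → (V :+ μ :* μ) :* s :+ q :* (s :+ (μ :* s :+ μ :* s :+ (V :+ μ :* μ) :* s))
           := ((V :+ μ :* μ :+ (con 1ℚ :+ μ :+ μ)) :* (con 1ℚ :+ q) :- (con 1ℚ :+ μ :+ μ) :* con 1ℚ) :* s) refl V μ s q ⟩
    ((V + μ * μ + (1ℚ + μ + μ)) * (1ℚ + q) - (1ℚ + μ + μ) * 1ℚ) * s
      ≡⟨ cong (λ z → ((V + μ * μ + (1ℚ + μ + μ)) * (1ℚ + q) - (1ℚ + μ + μ) * z) * s) rq≡1 ⟨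
    ((V + μ * μ + (1ℚ + μ + μ)) * (1ℚ + q) - (1ℚ + μ + μ) * (r * (1ℚ + q))) * s
      ≡⟨ solve 5 (λ V μ s q r → ((V :+ μ :* μ :+ (con 1ℚ :+ μ :+ μ)) :* (con 1ℚ :+ q) :- (con 1ℚ :+ μ :+ μ) :* (r :* (con 1ℚ :+ q))) :* s
           := (V :+ (r :- r :* r) :+ (μ :+ (con 1ℚ :- r)) :* (μ :+ (con 1ℚ :- r))) :* ((con 1ℚ :+ q) :* s)) refl V μ s q r ⟩
    (V + (r - r * r) + (μ + (1ℚ - r)) * (μ + (1ℚ - r))) * ((1ℚ + q) * s) ∎

1/[3+m] : ∀ m → (+ 1) / (3 ℕ.+ m) * (1ℚ + ℕ→ℚ (2 ℕ.+ m)) ≡ 1ℚ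
1/[3+m] m = trans (cong ((+ 1) / (3 ℕ.+ m) *_) (sym (ℕ→ℚ-suc (2 ℕ.+ m)))) (1/suc-inverse (2 ℕ.+ m))

first-moment : ∀ m → first m ≡ mean m * count m
-- For n = 2 the group is trivial, and 2 - 3/2 - 1/2 = 0 accounts for the constant 1/2.
first-moment zero    = refl
first-moment (suc m) = begin
  first (suc m)                              ≡⟨ first-suc m ⟩
  first m + q * (count m + first m)          ≡⟨ cong (λ s → s + q * (count m + s)) (first-moment m) ⟩
  mean m * count m + q * (count m + mean m * count m)
    ≡⟨ mean-step r q (1/[3+m] m) (mean m) (count m) ⟩
  (mean m + (1ℚ - r)) * ((1ℚ + q) * count m) ≡⟨ cong₂ _*_ (mean-suc m) (count-suc m) ⟨
  mean (suc m) * count (suc m)               ∎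
  where
  open ≡-Reasoning
  q = ℕ→ℚ (2 ℕ.+ m)
  r = (+ 1) / (3 ℕ.+ m)

second-moment : ∀ m → second m ≡ (variance m + mean m * mean m) * count m
-- Similarly 3/2 - 5/4 - 1/4 = 0 accounts for the constant 1/4.
second-moment zero    = refl
second-moment (suc m) = begin
  second (suc m)
    ≡⟨ second-suc m ⟩
  second m + q * (count m + (first m + first m + second m))
    ≡⟨ cong₂ (λ s t → t + q * (count m + (s + s + t))) (first-moment m) (second-moment m) ⟩
  (V + μ * μ) * count m + q * (count m + (μ * count m + μ * count m + (V + μ * μ) * count m))
    ≡⟨ second-step r q (1/[3+m] m) V μ (count m) ⟩
  (V + (r - r * r) + (μ + (1ℚ - r)) * (μ + (1ℚ - r))) * ((1ℚ + q) * count m)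
    ≡⟨ cong₂ _*_ (cong₂ (λ v e → v + e * e) (variance-suc m) (mean-suc m)) (count-suc m) ⟨
  (variance (suc m) + mean (suc m) * mean (suc m)) * count (suc m) ∎
  where
  open ≡-Reasoning
  q = ℕ→ℚ (2 ℕ.+ m)
  r = (+ 1) / (3 ℕ.+ m)
  μ = mean m
  V = variance m

-- Transfer of the moments to the length on the alternating group.

module _ (m : ℕ) (ℓ : Perm (2 ℕ.+ m) → ℕ) (isLength : ∀ v → v ∈ Alt (2 ℕ.+ m) → IsLengthOf m (ℓ v) v) where

  -- Two minimal lengths of the same element bound each other.
  length-codePerm : ∀ c → ℓ (codePerm c) ≡ weight c
  length-codePerm c = ℕₚ.≤-antisym
    (proj₂ ℓ-length (weight c) (proj₁ (codePerm-length c)))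
    (proj₂ (codePerm-length c) (ℓ (codePerm c)) (proj₁ ℓ-length))
    where ℓ-length = isLength (codePerm c) (codePerm∈Alt c)

  sum-Alt : ∀ F → sumℚ (F ∘ ℓ) (Alt (2 ℕ.+ m)) ≡ codeSum m F
  sum-Alt F = trans (sumℚ-↭ (F ∘ ℓ) (Alt↭codes m))
    (trans (sumℚ-map (F ∘ ℓ) codePerm (codes m))
      (sumℚ-cong (codes m) (λ {c} _ → cong F (length-codePerm c))))

  E-Alt : ∀ F e → codeSum m F ≡ e * count m → E (Alt (2 ℕ.+ m)) (F ∘ ℓ) ≡ e
  E-Alt F e eq = E-unique (codePerm∈Alt (identity m))
    (trans (sum-Alt F) (trans eq (cong (e *_) (sym (sum-Alt (const 1ℚ))))))

theorem8p4 : (m : ℕ) → (ℓ : Perm (suc (suc m)) → ℕ)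
    → ((v : Perm (suc (suc m))) → v ∈ Alt (suc (suc m)) → IsLengthOf m (ℓ v) v)
    → (E (Alt (suc (suc m))) (λ v → ℕ→ℚ (ℓ v))
    ≡ ℕ→ℚ (suc (suc m)) - H (suc (suc m)) - (+ 1) / 2)
    × (Var (Alt (suc (suc m))) (λ v → ℕ→ℚ (ℓ v))
    ≡ H (suc (suc m)) - H2 (suc (suc m)) - (+ 1) / 4)
theorem8p4 m ℓ isLength = E≡ , Var≡
  where
  E≡ = E-Alt m ℓ isLength ℕ→ℚ (mean m) (first-moment m)
  E²≡ = E-Alt m ℓ isLength (λ k → ℕ→ℚ k * ℕ→ℚ k) (variance m + mean m * mean m) (second-moment m)
  Var≡ = trans (cong₂ (λ s e → s - e * e) E²≡ E≡)
    (solve 2 (λ v e → v :+ e :* e :- e :* e := v) refl (variance m) (mean m))
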